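{- Let $\alpha\in A$ be an umbra with generating function $f(\alpha,t)$ and let $\boldsymbol{\mu}=(\mu_1,\ldots,\mu_n)$ be an $n$-tuple of umbral monomials with generating function $f(\boldsymbol{\mu},\boldsymbol{t})$, $\boldsymbol{t}=(t_1,\ldots,t_n)$. Then the auxiliary umbra $\alpha\boldsymbol{.}\beta\boldsymbol{.}\boldsymbol{\mu}$ has generating function $$f(\alpha\boldsymbol{.}\beta\boldsymbol{.}\boldsymbol{\mu},\boldsymbol{t})=f[\alpha,\,f(\boldsymbol{\mu},\boldsymbol{t})-1],$$ an identity of formal power series in $t_1,\dots,t_n$.
   Context: $R$ is the real or complex field, $A$ is a set (the alphabet) whose elements are called umbrae, and $E:R[A]\to R$ is a linear functional (evaluation) with $E[1]=1$ and $E[\alpha^i\gamma^j\cdots]=E[\alpha^i]E[\gamma^j]\cdots$ for distinct umbrae and nonnegative integers $i,j,\dots$. The moments of $\alpha\in A$ are $a_k=E[\alpha^k]$, and its generating function is $f(\alpha,t)=1+\sum_{k\ge1}a_k t^k/k!$. For formal power series $s$ without constant term, $f[\alpha,s]=1+\sum_{k\ge 1}a_k s^k/k!$. An $n$-tuple $\boldsymbol{\mu}=(\mu_1,\dots,\mu_n)$ of umbral monomials (monomials in $R[A]$, supports not necessarily disjoint) has multivariate moments $g_{\boldsymbol{i}}=E[\boldsymbol{\mu}^{\boldsymbol{i}}]$, $\boldsymbol{\mu}^{\boldsymbol{i}}=\mu_1^{i_1}\cdots\mu_n^{i_n}$, $\boldsymbol{i}\in\mathbb{N}_0^n$ (so $g_{\boldsymbol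 0}=1$), and generating function $f(\boldsymbol{\mu},\boldsymbol{t})=1+\sum_{\boldsymbol{i}\neq\boldsymbol{0}}g_{\boldsymbol{i}}\,\boldsymbol{t}^{\boldsymbol{i}}/\boldsymbol{i}!$ with $\boldsymbol{i}!=i_1!\cdots i_n!$ and $\boldsymbol{t}^{\boldsymbol{i}}=t_1^{i_1}\cdots t_n^{i_n}$. Partitions of a multi-index: a partition $\boldsymbol{\lambda}$ of $\boldsymbol{i}\in\mathbb{N}_0^n$, written $\boldsymbol{\lambda}\vdash\boldsymbol{i}$, is a matrix of nonnegative integers with $n$ rows, no zero column, columns in lexicographic order, and $r$-th row sum equal to $i_r$ for $r=1,\dots,n$. Its number of columns is $l(\boldsymbol{\lambda})$. Writing $\boldsymbol{\lambda}=(\boldsymbol{\lambda}_1^{r_1},\boldsymbol{\lambda}_2^{r_2},\dots)$ when the distinct column $\boldsymbol{\lambda}_j$ occurs $r_j$ times, set $\mathfrak{m}(\boldsymbol{\lambda})!=r_1!r_2!\cdots$ and $\boldsymbol{\lambda}!=\prod_j(\boldsymbol{\lambda}_j!)^{r_j}$ (product of factorials of all entries). Set $g_{\boldsymbol{\lambda}}=g_{\boldsymbol{\lambda}_1}^{r_1}g_{\boldsymbol{\lambda}_2}^{r_2}\cdots$. The auxiliary umbra $\alpha\boldsymbol{.}\beta\boldsymbol{.}\boldsymbol{\mu}$ ($\beta$ denotes the Bell umbra) is the symbolic $n$-tuple defined by its moments: $$E[(\alpha\boldsymbol{.}\beta\boldsymbol{.}\boldsymbol{\mu})^{\boldsymbol{i}}]=\sum_{\boldsymbol{\lambda}\vdash\boldsymbol{i}}\frac{\boldsymbol{i}!}{\mathfrak{m}(\boldsymbol{\lambda})!\,\boldsymbol{\lambda}!}\,a_{l(\boldsymbol{\lambda})}\,g_{\boldsymbol{\lambda}},\qquad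 \boldsymbol{i}\in\mathbb{N}_0^n,$$ and its generating function is $f(\alpha\boldsymbol{.}\beta\boldsymbol{.}\boldsymbol{\mu},\boldsymbol{t})=1+\sum_{\boldsymbol{i}\ne\boldsymbol{0}}E[(\alpha\boldsymbol{.}\beta\boldsymbol{.}\boldsymbol{\mu})^{\boldsymbol{i}}]\,\boldsymbol{t}^{\boldsymbol{i}}/\boldsymbol{i}!$. -}

module Defs where

open import Level using (Level; _⊔_) renaming (suc to lsuc)
open import Data.Nat.Base as ℕ using (ℕ; zero; suc; _≤_; _<_; NonZero; _!; z≤n; s≤s)
import Data.Nat.Properties as ℕₚ
import Data.Nat.ListAction as ℕ
import Data.Nat.ListAction.Properties as ℕₚ
open import Data.Bool.Base using (if_then_else_)
open import Data.Vec.Base as Vec using (Vec; []; _∷_)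
import Data.Vec.Properties as Vecₚ
open import Data.Vec.Relation.Binary.Lex.NonStrict as Lex using (Lex-≤)
open import Data.Vec.Relation.Binary.Pointwise.Inductive as Pointwise using (Pointwise; []; _∷_)
open import Data.List.Base as List
  using (List; []; _∷_; map; foldr; filter; length; upTo; cartesianProductWith; deduplicate)
open import Data.List.Relation.Unary.All as All using (All; []; _∷_)
import Data.List.Relation.Unary.All.Properties as Allₚ
open import Data.List.Relation.Unary.Any using (here; there)
open import Data.List.Relation.Unary.Linked as Linked using (Linked)
open import Data.List.Relation.Unary.AllPairs using ([]; _∷_)
open import Data.List.Relation.Unary.Unique.Propositional using (Unique)
import Data.List.Relation.Unary.Unique.Propositional.Properties as Uniqueₚ
open import Data.List.Membership.Propositional using (_∈_)
import Data.List.Membership.Propositional.Properties as ∈ₚ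
import Data.List.Properties as Listₚ
open import Data.Product.Base using (_×_; _,_; proj₁; proj₂)
open import Data.Empty using (⊥-elim)
open import Function.Base using (_∘_)
open import Relation.Nullary using (¬_; Dec; yes; no; does; ¬?; _×-dec_; map′)
open import Relation.Binary.PropositionalEquality as ≡ using (_≡_; _≢_)
open import Algebra.Bundles using (CommutativeRing; Semiring)
open import Algebra.Apartness.Bundles using (HeytingField)
import Algebra.Definitions.RawMonoid as RawMonoid
import Algebra.Definitions.RawSemiring as RawSemiring

MultiIndex : ℕ → Set
MultiIndex n = Vec ℕ n

module _ {n : ℕ} where

  infix 4 _≟ᵐ_ _≤ˡᵉˣ_ _≤ˡᵉˣ?_

  0ᵐ : MultiIndex n
  0ᵐ = Vec.replicate n 0

  _≟ᵐ_ : (i j : MultiIndex n) → Dec (i ≡ j)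
  _≟ᵐ_ = Vecₚ.≡-dec ℕₚ._≟_

  infixl 6 _+ᵐ_ _∸ᵐ_

  _+ᵐ_ _∸ᵐ_ : MultiIndex n → MultiIndex n → MultiIndex n
  _+ᵐ_ = Vec.zipWith ℕ._+_
  _∸ᵐ_ = Vec.zipWith ℕ._∸_

  _≤ˡᵉˣ_ : MultiIndex n → MultiIndex n → Set
  _≤ˡᵉˣ_ = Lex-≤ _≡_ _≤_

  _≤ˡᵉˣ?_ : (i j : MultiIndex n) → Dec (i ≤ˡᵉˣ j)
  _≤ˡᵉˣ?_ = Lex.≤-dec ℕₚ._≟_ ℕₚ._≤?_

infix 9 _!ᵐ

∣_∣ : ∀ {n} → MultiIndex n → ℕ
∣ i ∣ = Vec.sum i

_!ᵐ : ∀ {n} → MultiIndex n → ℕ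
[]      !ᵐ = 1
(x ∷ i) !ᵐ = x ! ℕ.* i !ᵐ

factorialᵐ-nonZero : ∀ {n} (i : MultiIndex n) → NonZero (i !ᵐ)
factorialᵐ-nonZero []      = _
factorialᵐ-nonZero (x ∷ i) = ℕₚ.m*n≢0 (x !) (i !ᵐ) {{x ℕₚ.!≢0}} {{factorialᵐ-nonZero i}}

below : ∀ {n} → MultiIndex n → List (MultiIndex n)
below []      = [] ∷ []
below (x ∷ i) = cartesianProductWith _∷_ (upTo (suc x)) (below i)

-- A matrix with n rows, given as the list of its columns.
ColumnList : ℕ → Set
ColumnList n = List (MultiIndex n)

module _ {n : ℕ} where

  rowSums : ColumnList n → MultiIndex n
  rowSums = foldr _+ᵐ_ 0ᵐ

  infix 4 _⊢_ _⊢?_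

  record _⊢_ (Λ : ColumnList n) (i : MultiIndex n) : Set where
    constructor partition
    field
      noZeroColumn : All (_≢ 0ᵐ) Λ
      sorted       : Linked _≤ˡᵉˣ_ Λ
      rowSums≡     : rowSums Λ ≡ i

  _⊢?_ : (Λ : ColumnList n) (i : MultiIndex n) → Dec (Λ ⊢ i)
  Λ ⊢? i = map′ (λ (p , q , r) → partition p q r) (λ (partition p q r) → p , q , r)
    (All.all? (λ c → ¬? (c ≟ᵐ 0ᵐ)) Λ ×-dec Linked.linked? _≤ˡᵉˣ?_ Λ ×-dec rowSums Λ ≟ᵐ i)

lists≤ : ∀ {a} {X : Set a} → List X → ℕ → List (List X)
lists≤ xs zero    = [] ∷ []
lists≤ xs (suc l) = [] ∷ cartesianProductWith _∷_ xs (lists≤ xs l)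

-- Each partition of i is listed exactly once, which is the content of
-- ∈-partitions⁺, ∈-partitions⁻ and partitions-unique below.
partitions : ∀ {n} → MultiIndex n → List (ColumnList n)
partitions i = filter (_⊢? i) (lists≤ (below i) ∣ i ∣)

module _ {n : ℕ} where

  distinctColumns : ColumnList n → List (MultiIndex n)
  distinctColumns = deduplicate _≟ᵐ_

  multiplicity : MultiIndex n → ColumnList n → ℕ
  multiplicity c Λ = length (filter (c ≟ᵐ_) Λ)

  𝔪[_]! : ColumnList n → ℕ
  𝔪[ Λ ]! = ℕ.product (map (λ c → multiplicity c Λ !) (distinctColumns Λ))

  infix 9 _!ᵖ

  _!ᵖ : ColumnList n → ℕ
  Λ !ᵖ = ℕ.product (map (λ c → c !ᵐ ℕ.^ multiplicity c Λ) (distinctColumns Λ))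

  product-map-nonZero : ∀ (f : MultiIndex n → ℕ) → (∀ c → NonZero (f c)) →
                        ∀ cs → NonZero (ℕ.product (map f cs))
  product-map-nonZero f nz cs = ℕₚ.product≢0 (Allₚ.map⁺ (All.universal nz cs))

  𝔪!*!ᵖ-nonZero : ∀ Λ → NonZero (𝔪[ Λ ]! ℕ.* Λ !ᵖ)
  𝔪!*!ᵖ-nonZero Λ = ℕₚ.m*n≢0 _ _
    {{product-map-nonZero _ (λ c → multiplicity c Λ ℕₚ.!≢0) (distinctColumns Λ)}}
    {{product-map-nonZero _ (λ c → ℕₚ.m^n≢0 (c !ᵐ) (multiplicity c Λ) {{factorialᵐ-nonZero c}})
                          (distinctColumns Λ)}}

infix 4 _≤ᵐ_

_≤ᵐ_ : ∀ {n} → MultiIndex n → MultiIndex n → Set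
_≤ᵐ_ = Pointwise _≤_

∈-below⁺ : ∀ {n} {i j : MultiIndex n} → j ≤ᵐ i → j ∈ below i
∈-below⁺ []         = here ≡.refl
∈-below⁺ (x≤y ∷ ps) = ∈ₚ.∈-cartesianProductWith⁺ _∷_ (∈ₚ.∈-upTo⁺ (s≤s x≤y)) (∈-below⁺ ps)

∈-below⁻ : ∀ {n} {i j : MultiIndex n} → j ∈ below i → j ≤ᵐ i
∈-below⁻ {i = []}    {[]} _ = []
∈-below⁻ {i = x ∷ i} j∈
  with _ , _ , y∈ , k∈ , ≡.refl ← ∈ₚ.∈-cartesianProductWith⁻ _∷_ (upTo (suc x)) (below i) j∈
  = ℕₚ.≤-pred (∈ₚ.∈-upTo⁻ y∈) ∷ ∈-below⁻ k∈

below-unique : ∀ {n} (i : MultiIndex n) → Unique (below i)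
below-unique []      = [] ∷ []
below-unique (x ∷ i) =
  Uniqueₚ.cartesianProductWith⁺ _∷_ Vecₚ.∷-injective (Uniqueₚ.upTo⁺ (suc x)) (below-unique i)

module _ {a} {X : Set a} where

  ∈-lists≤⁺ : ∀ {xs : List X} {l ys} → All (_∈ xs) ys → length ys ≤ l → ys ∈ lists≤ xs l
  ∈-lists≤⁺ {l = zero}  []       _       = here ≡.refl
  ∈-lists≤⁺ {l = suc l} []       _       = here ≡.refl
  ∈-lists≤⁺ {l = suc l} (p ∷ ps) (s≤s q) =
    there (∈ₚ.∈-cartesianProductWith⁺ _∷_ p (∈-lists≤⁺ ps q))

  lists≤-unique : ∀ {xs : List X} → Unique xs → ∀ l → Unique (lists≤ xs l)
  lists≤-unique {xs} u zero    = [] ∷ []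
  lists≤-unique {xs} u (suc l) =
    All.tabulate []∉ ∷ Uniqueₚ.cartesianProductWith⁺ _∷_ Listₚ.∷-injective u (lists≤-unique u l)
    where
    []∉ : ∀ {zs} → zs ∈ cartesianProductWith _∷_ xs (lists≤ xs l) → [] ≢ zs
    []∉ zs∈ ≡.refl with ∈ₚ.∈-cartesianProductWith⁻ _∷_ xs (lists≤ xs l) zs∈
    ... | _ , _ , _ , _ , ()

≤ᵐ-+ʳ : ∀ {n} (i j : MultiIndex n) → i ≤ᵐ i +ᵐ j
≤ᵐ-+ʳ []      []      = []
≤ᵐ-+ʳ (x ∷ i) (y ∷ j) = ℕₚ.m≤m+n x y ∷ ≤ᵐ-+ʳ i j

≤ᵐ-+ˡ : ∀ {n} (i j : MultiIndex n) → j ≤ᵐ i +ᵐ j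
≤ᵐ-+ˡ []      []      = []
≤ᵐ-+ˡ (x ∷ i) (y ∷ j) = ℕₚ.m≤n+m y x ∷ ≤ᵐ-+ˡ i j

∣∣-mono : ∀ {n} {i j : MultiIndex n} → i ≤ᵐ j → ∣ i ∣ ≤ ∣ j ∣
∣∣-mono []       = z≤n
∣∣-mono (p ∷ ps) = ℕₚ.+-mono-≤ p (∣∣-mono ps)

∣∣-+ : ∀ {n} (i j : MultiIndex n) → ∣ i +ᵐ j ∣ ≡ ∣ i ∣ ℕ.+ ∣ j ∣
∣∣-+ []      []      = ≡.refl
∣∣-+ (x ∷ i) (y ∷ j) = ≡.trans (≡.cong (x ℕ.+ y ℕ.+_) (∣∣-+ i j)) (interchange x y ∣ i ∣ ∣ j ∣)
  where open import Algebra.Properties.CommutativeSemigroup ℕₚ.+-commutativeSemigroup using (interchange)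

∣∣-∸ : ∀ {n} {i j : MultiIndex n} → j ≤ᵐ i → ∣ j ∣ ℕ.+ ∣ i ∸ᵐ j ∣ ≡ ∣ i ∣
∣∣-∸ {i = i} {j} j≤i = ≡.trans (≡.sym (∣∣-+ j (i ∸ᵐ j))) (≡.cong ∣_∣ (lemma j≤i))
  where
  lemma : ∀ {n} {i j : MultiIndex n} → j ≤ᵐ i → j +ᵐ (i ∸ᵐ j) ≡ i
  lemma []       = ≡.refl
  lemma (p ∷ ps) = ≡.cong₂ _∷_ (ℕₚ.m+[n∸m]≡n p) (lemma ps)

≢0ᵐ⇒∣∣>0 : ∀ {n} (i : MultiIndex n) → i ≢ 0ᵐ → 0 < ∣ i ∣
≢0ᵐ⇒∣∣>0 []          i≢0 = ⊥-elim (i≢0 ≡.refl)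
≢0ᵐ⇒∣∣>0 (zero ∷ i)  i≢0 = ≢0ᵐ⇒∣∣>0 i (i≢0 ∘ ≡.cong (0 ∷_))
≢0ᵐ⇒∣∣>0 (suc x ∷ i) _   = s≤s z≤n

columns-below : ∀ {n} (Λ : ColumnList n) {i} → rowSums Λ ≤ᵐ i → All (_∈ below i) Λ
columns-below []      _ = []
columns-below (c ∷ Λ) p =
  ∈-below⁺ (Pointwise.trans ℕₚ.≤-trans (≤ᵐ-+ʳ c (rowSums Λ)) p)
  ∷ columns-below Λ (Pointwise.trans ℕₚ.≤-trans (≤ᵐ-+ˡ c (rowSums Λ)) p)

length≤∣rowSums∣ : ∀ {n} {Λ : ColumnList n} → All (_≢ 0ᵐ) Λ → length Λ ≤ ∣ rowSums Λ ∣
length≤∣rowSums∣ []                   = z≤n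
length≤∣rowSums∣ {Λ = c ∷ Λ} (p ∷ ps) =
  ≡.subst (suc (length Λ) ≤_) (≡.sym (∣∣-+ c (rowSums Λ)))
    (ℕₚ.+-mono-≤ (≢0ᵐ⇒∣∣>0 c p) (length≤∣rowSums∣ ps))

module _ {n : ℕ} {i : MultiIndex n} where

  ∈-partitions⁺ : ∀ {Λ} → Λ ⊢ i → Λ ∈ partitions i
  ∈-partitions⁺ {Λ} Λ⊢i@(partition nz _ ≡.refl) = ∈ₚ.∈-filter⁺ (_⊢? i)
    (∈-lists≤⁺ (columns-below Λ (Pointwise.refl ℕₚ.≤-refl)) (length≤∣rowSums∣ nz)) Λ⊢i

  ∈-partitions⁻ : ∀ {Λ} → Λ ∈ partitions i → Λ ⊢ i
  ∈-partitions⁻ = proj₂ ∘ ∈ₚ.∈-filter⁻ (_⊢? i) {xs = lists≤ (below i) ∣ i ∣}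

  partitions-unique : Unique (partitions i)
  partitions-unique = Uniqueₚ.filter⁺ (_⊢? i) (lists≤-unique (below-unique i) ∣ i ∣)

-- The standard library has neither the real nor the complex field.
-- Both are instances of this structure.
record CharZeroField c ℓ₁ ℓ₂ : Set (lsuc (c ⊔ ℓ₁ ⊔ ℓ₂)) where
  field
    heytingField : HeytingField c ℓ₁ ℓ₂

  open HeytingField heytingField public

  commutativeRing : CommutativeRing c ℓ₁
  commutativeRing = record { isCommutativeRing = isCommutativeRing }

  open CommutativeRing commutativeRing public using (+-rawMonoid; semiring)
  open RawMonoid +-rawMonoid public using () renaming (_×_ to _·ℕ_)
  open RawSemiring (Semiring.rawSemiring semiring) public using (_^_)

  field
    charZero : ∀ m .{{_ : NonZero m}} → (m ·ℕ 1#) # 0#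

  ∑ ∏ : List Carrier → Carrier
  ∑ = foldr _+_ 0#
  ∏ = foldr _*_ 1#

  infixl 7 _÷_

  _÷_ : Carrier → (m : ℕ) .{{_ : NonZero m}} → Carrier
  x ÷ m = x * proj₁ (#⇒invertible (charZero m))

module PowerSeries {c ℓ₁ ℓ₂} (K : CharZeroField c ℓ₁ ℓ₂) (n : ℕ) where

  open CharZeroField K

  Series : Set c
  Series = MultiIndex n → Carrier

  infix  4 _≈ₛ_
  infixl 6 _+ₛ_ _-ₛ_
  infixl 7 _*ₛ_ _·ₛ_
  infixr 8 _^ₛ_

  _≈ₛ_ : Series → Series → Set ℓ₁
  s ≈ₛ t = ∀ i → s i ≈ t i

  1ₛ : Series
  1ₛ i = if does (i ≟ᵐ 0ᵐ) then 1# else 0#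

  _+ₛ_ _-ₛ_ _*ₛ_ : Series → Series → Series
  (s +ₛ t) i = s i + t i
  (s -ₛ t) i = s i - t i
  (s *ₛ t) i = ∑ (map (λ j → s j * t (i ∸ᵐ j)) (below i))

  _·ₛ_ : Carrier → Series → Series
  (x ·ₛ s) i = x * s i

  _^ₛ_ : Series → ℕ → Series
  s ^ₛ zero  = 1ₛ
  s ^ₛ suc k = s *ₛ s ^ₛ k

  NoConstantTerm : Series → Set ℓ₁
  NoConstantTerm s = s 0ᵐ ≈ 0#

  -- A family has a (formal) infinite sum when every coefficient vanishes for
  -- all but finitely many of its members. The value of the sum does not depend
  -- on the bounds chosen.
  record LocallyFinite (u : ℕ → Series) : Set (c ⊔ ℓ₁) where
    field
      bound    : MultiIndex n → ℕ
      vanishes : ∀ i k → bound i ≤ k → u k i ≈ 0#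

  ∑∞ : (u : ℕ → Series) → LocallyFinite u → Series
  ∑∞ u fin i = ∑ (map (λ k → u k i) (upTo (LocallyFinite.bound fin i)))

  ∑-zero : ∀ {a} {X : Set a} (f : X → Carrier) xs → All (λ x → f x ≈ 0#) xs → ∑ (map f xs) ≈ 0#
  ∑-zero f []       []       = refl
  ∑-zero f (x ∷ xs) (p ∷ ps) = trans (+-cong p (∑-zero f xs ps)) (+-identityˡ 0#)

  vanish : ∀ {s} → NoConstantTerm s → ∀ k i → ∣ i ∣ < k → (s ^ₛ k) i ≈ 0#
  vanish {s} s₀ (suc k) i (s≤s ∣i∣≤k) = ∑-zero _ (below i) (All.tabulate (term ∘ ∈-below⁻))
    where
    term : ∀ {j} → j ≤ᵐ i → s j * (s ^ₛ k) (i ∸ᵐ j) ≈ 0#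
    term {j} j≤i with j ≟ᵐ 0ᵐ
    ... | yes ≡.refl = trans (*-congʳ s₀) (zeroˡ _)
    ... | no j≢0     = trans (*-congˡ (vanish s₀ k (i ∸ᵐ j) (ℕₚ.<-≤-trans smaller ∣i∣≤k))) (zeroʳ _)
      where
      smaller : ∣ i ∸ᵐ j ∣ < ∣ i ∣
      smaller = ≡.subst (∣ i ∸ᵐ j ∣ <_) (∣∣-∸ j≤i)
        (ℕₚ.m<n+m ∣ i ∸ᵐ j ∣ (≢0ᵐ⇒∣∣>0 j j≢0))

  powers-locallyFinite : (b : ℕ → Carrier) (s : Series) → NoConstantTerm s →
                         LocallyFinite (λ k → b k ·ₛ s ^ₛ suc k)
  powers-locallyFinite b s s₀ = record
    { bound    = ∣_∣
    ; vanishes = λ i k ∣i∣≤k → trans (*-congˡ (vanish s₀ (suc k) i (s≤s ∣i∣≤k))) (zeroʳ _)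
    }

  -- 1 + ∑_{i ≠ 0} mᵢ tⁱ / i!
  generatingFunction : (MultiIndex n → Carrier) → Series
  generatingFunction m i = if does (i ≟ᵐ 0ᵐ) then 1# else (m i ÷ i !ᵐ) {{factorialᵐ-nonZero i}}

  generatingFunction-1-noConstantTerm : ∀ m → NoConstantTerm (generatingFunction m -ₛ 1ₛ)
  generatingFunction-1-noConstantTerm m with 0ᵐ {n} ≟ᵐ 0ᵐ
  ... | yes _  = -‿inverseʳ 1#
  ... | no 0≢0 = ⊥-elim (0≢0 ≡.refl)

  -- 1 + ∑_{k ≥ 1} aₖ sᵏ / k!, with summation index shifted by one
  compose : (ℕ → Carrier) → (s : Series) → NoConstantTerm s → Series
  compose a s s₀ = 1ₛ +ₛ ∑∞ (λ k → coeff k ·ₛ s ^ₛ suc k) (powers-locallyFinite coeff s s₀)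
    where
    coeff : ℕ → Carrier
    coeff k = (a (suc k) ÷ suc k !) {{suc k ℕₚ.!≢0}}

-- K[A] is presented as the free commutative K-algebra on A.
module Polynomials {c ℓ₁ ℓ₂ a} (K : CharZeroField c ℓ₁ ℓ₂) (A : Set a) where

  open CharZeroField K using (Carrier; _≈_; 0#; 1#) renaming (_+_ to _+ᴷ_; _*_ to _*ᴷ_)

  infix  4 _≈ₚ_
  infixl 6 _+ₚ_
  infixl 7 _*ₚ_
  infixr 8 _^ₚ_ _^ᵐ_

  data Poly : Set (c ⊔ a) where
    con       : Carrier → Poly
    var       : A → Poly
    _+ₚ_ _*ₚ_ : Poly → Poly → Poly

  data _≈ₚ_ : Poly → Poly → Set (c ⊔ ℓ₁ ⊔ a) where
    reflₚ   : ∀ {p} → p ≈ₚ p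
    symₚ    : ∀ {p q} → p ≈ₚ q → q ≈ₚ p
    transₚ  : ∀ {p q r} → p ≈ₚ q → q ≈ₚ r → p ≈ₚ r
    +-congₚ : ∀ {p p′ q q′} → p ≈ₚ p′ → q ≈ₚ q′ → p +ₚ q ≈ₚ p′ +ₚ q′
    *-congₚ : ∀ {p p′ q q′} → p ≈ₚ p′ → q ≈ₚ q′ → p *ₚ q ≈ₚ p′ *ₚ q′
    +-assocₚ     : ∀ p q r → (p +ₚ q) +ₚ r ≈ₚ p +ₚ (q +ₚ r)
    +-commₚ      : ∀ p q → p +ₚ q ≈ₚ q +ₚ p
    +-identityˡₚ : ∀ p → con 0# +ₚ p ≈ₚ p
    *-assocₚ     : ∀ p q r → (p *ₚ q) *ₚ r ≈ₚ p *ₚ (q *ₚ r)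
    *-commₚ      : ∀ p q → p *ₚ q ≈ₚ q *ₚ p
    *-identityˡₚ : ∀ p → con 1# *ₚ p ≈ₚ p
    *-zeroˡₚ     : ∀ p → con 0# *ₚ p ≈ₚ con 0#
    *-distribˡₚ  : ∀ p q r → p *ₚ (q +ₚ r) ≈ₚ (p *ₚ q) +ₚ (p *ₚ r)
    con-cong : ∀ {x y} → x ≈ y → con x ≈ₚ con y
    con-+    : ∀ x y → con (x +ᴷ y) ≈ₚ con x +ₚ con y
    con-*    : ∀ x y → con (x *ᴷ y) ≈ₚ con x *ₚ con y

  _^ₚ_ : Poly → ℕ → Poly
  p ^ₚ zero  = con 1#
  p ^ₚ suc k = p *ₚ p ^ₚ k

  ∏ₚ : List Poly → Poly
  ∏ₚ = foldr _*ₚ_ (con 1#)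

  _^ᵐ_ : ∀ {n} → Vec Poly n → MultiIndex n → Poly
  []       ^ᵐ []      = con 1#
  (p ∷ ps) ^ᵐ (k ∷ i) = p ^ₚ k *ₚ ps ^ᵐ i

  -- A monomial is given by its umbrae, listed with multiplicity in any order.
  monomial : List A → Poly
  monomial w = ∏ₚ (map var w)

Monomial : ∀ {a} → Set a → Set a
Monomial = List

record Evaluation {c ℓ₁ ℓ₂ a} (K : CharZeroField c ℓ₁ ℓ₂) (A : Set a) : Set (c ⊔ ℓ₁ ⊔ a) where
  open CharZeroField K
  open Polynomials K A
  field
    E             : Poly → Carrier
    E-cong        : ∀ {p q} → p ≈ₚ q → E p ≈ E q
    E-additive    : ∀ p q → E (p +ₚ q) ≈ E p + E q
    E-homogeneous : ∀ x p → E (con x *ₚ p) ≈ x * E p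
    E-1           : E (con 1#) ≈ 1#
    uncorrelated  : (powers : List (A × ℕ)) → Unique (map proj₁ powers) →
                    E (∏ₚ (map (λ (α , i) → var α ^ₚ i) powers))
                      ≈ ∏ (map (λ (α , i) → E (var α ^ₚ i)) powers)

module Umbrae {c ℓ₁ ℓ₂ a} {K : CharZeroField c ℓ₁ ℓ₂} {A : Set a} (𝔼 : Evaluation K A) where

  open CharZeroField K
  open Polynomials K A
  open Evaluation 𝔼

  moment : A → ℕ → Carrier
  moment α k = E (var α ^ₚ k)

  moments : ∀ {n} → Vec (Monomial A) n → MultiIndex n → Carrier
  moments μ i = E (Vec.map monomial μ ^ᵐ i)

  columnProduct : ∀ {n} → (MultiIndex n → Carrier) → ColumnList n → Carrier
  columnProduct g Λ = ∏ (map (λ c → g c ^ multiplicity c Λ) (distinctColumns Λ))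

  auxiliaryMoments : ∀ {n} → A → Vec (Monomial A) n → MultiIndex n → Carrier
  auxiliaryMoments α μ i = ∑ (map term (partitions i))
    where
    term : ColumnList _ → Carrier
    term Λ = (((i !ᵐ) ·ℕ 1#) ÷ (𝔪[ Λ ]! ℕ.* Λ !ᵖ)) {{𝔪!*!ᵖ-nonZero Λ}}
             * moment α (length Λ) * columnProduct (moments μ) Λ

  module _ {n : ℕ} where

    open PowerSeries K n

    f⟨_⟩ : Vec (Monomial A) n → Series
    f⟨ μ ⟩ = generatingFunction (moments μ)

    f⟨_∙β∙_⟩ : A → Vec (Monomial A) n → Series
    f⟨ α ∙β∙ μ ⟩ = generatingFunction (auxiliaryMoments α μ)

    f[_,_] : A → (s : Series) → NoConstantTerm s → Series
    f[ α , s ] s₀ = compose (moment α) s s₀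

{-# OPTIONS --safe #-}
module Submission where

-- Put s = f(μ,t) - 1, and give a partition Λ with columns c of multiplicity r_c
-- the weight ∏ s_c^{r_c} / r_c!, so that the i-th moment of α.β.μ is i! times
-- the sum of a_{l(Λ)} weight(Λ) over Λ ⊢ i. Let W_k be the series whose i-th
-- coefficient is the total weight of the partitions of i of length k. Writing
-- the length of Λ as the sum of its multiplicities and removing one copy of a
-- column c, which turns r_c weight(Λ) into s_c weight(Λ - c), gives
-- (k+1) W_{k+1} = s W_k. Hence k! W_k = s^k, without any count of the orderings
-- of the columns.

open import Level using (Level)
open import Data.Nat using (ℕ; zero; suc; _!; NonZero)
import Data.Nat as ℕ
import Data.Nat.ListAction as ℕ
import Data.Nat.Properties as ℕₚ
open import Data.Bool.Base using (if_then_else_)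
open import Data.Vec using (Vec; []; _∷_)
import Data.Vec.Properties as Vecₚ
import Data.Vec.Relation.Binary.Lex.NonStrict as Lex
open import Data.Vec.Relation.Binary.Pointwise.Inductive as VecPointwise using ([]; _∷_; Pointwise-≡⇒≡)
open import Data.List using (List; []; _∷_; _++_; map; foldr; filter; length; upTo)
import Data.List.Properties as Listₚ
open import Data.List.Relation.Unary.All as All using (All; []; _∷_)
import Data.List.Relation.Unary.All.Properties as Allₚ
open import Data.List.Relation.Unary.Any using (here; there)
open import Data.List.Relation.Unary.AllPairs using ([]; _∷_)
open import Data.List.Relation.Unary.Unique.Propositional using (Unique)
import Data.List.Relation.Unary.Unique.Propositional.Properties as Uniqueₚ
import Data.List.Relation.Unary.Unique.DecPropositional.Properties as DecUniqueₚ
import Data.List.Relation.Binary.Pointwise as Pointwise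
open import Data.List.Relation.Binary.BagAndSetEquality using (∼bag⇒↭)
open import Data.List.Relation.Binary.Permutation.Propositional
  using (_↭_; ↭-sym; ↭-trans; ↭-prep; ↭⇒↭ₛ; ↭⇒↭ₛ′)
import Data.List.Relation.Binary.Permutation.Propositional.Properties as Permₚ
import Data.List.Relation.Binary.Permutation.Setoid.Properties as SetoidPermₚ
open import Data.List.Relation.Unary.Linked using (Linked; [])
open import Data.List.Relation.Unary.Sorted.TotalOrder.Properties using (↗↭↗⇒≋)
import Data.List.Sort.InsertionSort.Base as InsertionSort
import Data.List.Sort.InsertionSort.Properties as InsertionSortₚ
open import Data.List.Membership.Propositional using (_∈_; _∉_)
import Data.List.Membership.Propositional.Properties as ∈ₚ
open import Data.List.Membership.Propositional.Properties.WithK using (unique∧set⇒bag)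
import Data.List.Membership.DecPropositional as DecMembership
open import Data.Product using (_×_; _,_; proj₁; proj₂)
open import Data.Empty using (⊥-elim)
open import Function using (_∘_; mk⇔)
open import Relation.Nullary using (¬_; Dec; yes; no; does; ¬?)
open import Relation.Unary using (Pred; Decidable)
open import Relation.Binary using (DecidableEquality; DecTotalOrder)
open import Relation.Binary.PropositionalEquality as ≡ using (_≡_; _≢_)
import Relation.Binary.Reasoning.Setoid as SetoidReasoning
open import Algebra.Bundles using (CommutativeMonoid; CommutativeRing)
import Algebra.Properties.CommutativeSemigroup as CommutativeSemigroupₚ
import Algebra.Properties.CommutativeSemiring.Exp as Expₚ
import Algebra.Properties.Semiring.Exp as SemiringExpₚ
import Algebra.Properties.Semiring.Mult as Multₚ
import Algebra.Properties.Ring as Ringₚ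
open import Defs

private variable
  ℓx ℓy ℓp : Level
  X : Set ℓx
  Y : Set ℓy

-- Rearranging lists without repetitions.

unique∧set⇒↭ : {xs ys : List X} → Unique xs → Unique ys →
               (∀ {z} → z ∈ xs → z ∈ ys) → (∀ {z} → z ∈ ys → z ∈ xs) → xs ↭ ys
unique∧set⇒↭ xs! ys! xs⊆ys ys⊆xs = ∼bag⇒↭ (unique∧set⇒bag xs! ys! (mk⇔ xs⊆ys ys⊆xs))

-- Injectivity is asked only between members of the list, because for `insertColumn c` it is derived
-- from the sortedness of the partitions listed.
map-unique : {φ : Y → X} {ys : List Y} →
             (∀ {y z} → y ∈ ys → z ∈ ys → φ y ≡ φ z → y ≡ z) → Unique ys → Unique (map φ ys)
map-unique inj []           = []
map-unique inj (y∉ys ∷ ys!) =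
  Allₚ.map⁺ (All.tabulate λ z∈ → All.lookup y∉ys z∈ ∘ inj (here ≡.refl) (there z∈))
  ∷ map-unique (λ p q → inj (there p) (there q)) ys!

-- Finite sums and products, treated together over a commutative monoid.

module BigOperator {c ℓ} (M : CommutativeMonoid c ℓ) where

  open CommutativeMonoid M 
  open CommutativeSemigroupₚ commutativeSemigroup using (interchange; x∙yz≈y∙xz)
  open SetoidReasoning setoid

  ⨁ : List X → (X → Carrier) → Carrier
  ⨁ xs f = foldr _∙_ ε (map f xs)

  ⨁-cong : ∀ (xs : List X) {f g} → (∀ {x} → x ∈ xs → f x ≈ g x) → ⨁ xs f ≈ ⨁ xs g
  ⨁-cong []       eq = refl
  ⨁-cong (x ∷ xs) eq = ∙-cong (eq (here ≡.refl)) (⨁-cong xs (eq ∘ there))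

  ⨁-ε : ∀ (xs : List X) → ⨁ xs (λ _ → ε) ≈ ε
  ⨁-ε []       = refl
  ⨁-ε (x ∷ xs) = trans (identityˡ _) (⨁-ε xs)

  ⨁-∙ : ∀ (xs : List X) {f g} → ⨁ xs (λ x → f x ∙ g x) ≈ ⨁ xs f ∙ ⨁ xs g
  ⨁-∙ []       = sym (identityˡ ε)
  ⨁-∙ (x ∷ xs) = trans (∙-congˡ (⨁-∙ xs)) (interchange _ _ _ _)

  ⨁-swap : ∀ (xs : List X) (ys : List Y) {f : X → Y → Carrier} →
           ⨁ xs (λ x → ⨁ ys (f x)) ≈ ⨁ ys (λ y → ⨁ xs (λ x → f x y))
  ⨁-swap []       ys = sym (⨁-ε ys)
  ⨁-swap (x ∷ xs) ys = trans (∙-congˡ (⨁-swap xs ys)) (sym (⨁-∙ ys))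

  ⨁-↭ : ∀ {xs ys : List X} f → xs ↭ ys → ⨁ xs f ≈ ⨁ ys f
  ⨁-↭ f σ = SetoidPermₚ.foldr-commMonoid setoid isCommutativeMonoid
              (↭⇒↭ₛ′ isEquivalence (Permₚ.map⁺ f σ))

  ⨁-map : ∀ (φ : Y → X) ys {f} → ⨁ (map φ ys) f ≈ ⨁ ys (f ∘ φ)
  ⨁-map φ ys = reflexive (≡.cong (foldr _∙_ ε) (≡.sym (Listₚ.map-∘ ys)))

  ⨁-filter : ∀ {P : Pred X ℓp} (P? : Decidable P) xs {f} →
             ⨁ (filter P? xs) f ≈ ⨁ xs (λ x → if does (P? x) then f x else ε)
  ⨁-filter P? []       = refl
  ⨁-filter P? (x ∷ xs) with P? x
  ... | yes _ = ∙-congˡ (⨁-filter P? xs)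
  ... | no  _ = trans (⨁-filter P? xs) (sym (identityˡ _))

  ⨁-support : ∀ {P : Pred X ℓp} (P? : Decidable P) xs {f} →
              (∀ {x} → x ∈ xs → ¬ P x → f x ≈ ε) → ⨁ xs f ≈ ⨁ (filter P? xs) f
  ⨁-support P? xs {f} vanishes = trans (⨁-cong xs restrict) (sym (⨁-filter P? xs))
    where
    restrict : ∀ {x} → x ∈ xs → f x ≈ (if does (P? x) then f x else ε)
    restrict {x} x∈xs with P? x
    ... | yes _ = refl
    ... | no ¬p = vanishes x∈xs ¬p

  module _ (_≟_ : DecidableEquality X) where

    -- If `c` is absent, the filter removes nothing and the extra factor `f c` is neutral. Covering
    -- this case lets `weight-∷` treat old and new columns alike.
    ⨁-remove : ∀ {xs} c {f} → Unique xs → (c ∉ xs → f c ≈ ε) →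
               ⨁ xs f ≈ f c ∙ ⨁ (filter (¬? ∘ (c ≟_)) xs) f
    ⨁-remove {[]}     c []           fc≈ε = sym (trans (identityʳ _) (fc≈ε λ ()))
    ⨁-remove {x ∷ xs} c (x∉xs ∷ xs!) fc≈ε with c ≟ x
    ... | yes ≡.refl rewrite Listₚ.filter-all (¬? ∘ (c ≟_)) x∉xs = refl
    ... | no  c≢x    = trans (∙-congˡ (⨁-remove c xs! (λ c∉ → fc≈ε λ
            { (here c≡x) → c≢x c≡x ; (there c∈) → c∉ c∈ }))) (x∙yz≈y∙xz _ _ _)

    ⨁-single : ∀ {ks c} → Unique ks → c ∈ ks → ∀ z →
               ⨁ ks (λ k → if does (k ≟ c) then z else ε) ≈ z
    ⨁-single {ks} {c} ks! c∈ks z = begin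
      ⨁ ks δ                                ≈⟨ ⨁-remove c ks! (λ c∉ → ⊥-elim (c∉ c∈ks)) ⟩
      δ c ∙ ⨁ (filter (¬? ∘ (c ≟_)) ks) δ   ≈⟨ ∙-cong (reflexive δ-diagonal)
                                                (trans (⨁-cong others off) (⨁-ε others)) ⟩
      z ∙ ε                                 ≈⟨ identityʳ z ⟩
      z                                     ∎
      where
      δ : X → Carrier
      δ k = if does (k ≟ c) then z else ε
      others = filter (¬? ∘ (c ≟_)) ks
      δ-diagonal : δ c ≡ z
      δ-diagonal with c ≟ c
      ... | yes _  = ≡.refl
      ... | no c≢c = ⊥-elim (c≢c ≡.refl)
      off : ∀ {k} → k ∈ others → δ k ≈ ε
      off {k} k∈ with k ≟ c
      ... | no _     = refl
      ... | yes ≡.refl = ⊥-elim (proj₂ (∈ₚ.∈-filter⁻ (¬? ∘ (c ≟_)) {xs = ks} k∈) ≡.refl)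

    -- Each `f y` is spread over all keys by a Kronecker delta at `h y`, which hits `ks` exactly
    -- once; then the two sums are exchanged.
    ⨁-fibres : ∀ (h : Y → X) {ks} ys {f} → Unique ks → (∀ {y} → y ∈ ys → h y ∈ ks) →
               ⨁ ys f ≈ ⨁ ks (λ k → ⨁ (filter (λ y → k ≟ h y) ys) f)
    ⨁-fibres h {ks} ys {f} ks! h∈ks = begin
      ⨁ ys f
        ≈⟨ ⨁-cong ys (λ y∈ → ⨁-single ks! (h∈ks y∈) _) ⟨
      ⨁ ys (λ y → ⨁ ks (λ k → if does (k ≟ h y) then f y else ε))
        ≈⟨ ⨁-swap ys ks ⟩
      ⨁ ks (λ k → ⨁ ys (λ y → if does (k ≟ h y) then f y else ε))
        ≈⟨ ⨁-cong ks (λ {k} _ → ⨁-filter (λ y → k ≟ h y) ys) ⟨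
      ⨁ ks (λ k → ⨁ (filter (λ y → k ≟ h y) ys) f)
        ∎

-- Multi-indices, partitions and multiplicities of columns.

+ᵐ-∸ᵐ-cancel : ∀ {n} (i j : MultiIndex n) → (i +ᵐ j) ∸ᵐ i ≡ j
+ᵐ-∸ᵐ-cancel []      []      = ≡.refl
+ᵐ-∸ᵐ-cancel (x ∷ i) (y ∷ j) = ≡.cong₂ _∷_ (ℕₚ.m+n∸m≡n x y) (+ᵐ-∸ᵐ-cancel i j)

j+[i∸j]≡i : ∀ {n} {i j : MultiIndex n} → j ≤ᵐ i → j +ᵐ (i ∸ᵐ j) ≡ i
j+[i∸j]≡i []       = ≡.refl
j+[i∸j]≡i (p ∷ ps) = ≡.cong₂ _∷_ (ℕₚ.m+[n∸m]≡n p) (j+[i∸j]≡i ps)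

∣0ᵐ∣≡0 : ∀ n → ∣ 0ᵐ {n} ∣ ≡ 0
∣0ᵐ∣≡0 zero    = ≡.refl
∣0ᵐ∣≡0 (suc n) = ∣0ᵐ∣≡0 n

module _ {n : ℕ} where

  private
    lex : DecTotalOrder _ _ _
    lex = Lex.≤-decTotalOrder ℕₚ.≤-decTotalOrder n

  open InsertionSort lex using (insert; sort)
  open InsertionSortₚ lex using (insert-↭; insert-↗; sort-↭; sort-↗)

  -- The lexicographic order is total and antisymmetric, so a multiset of columns has one sorted
  -- arrangement. The equality of that order is pointwise on vectors, hence the two conversions.
  sorted-↭⇒≡ : {Λ Λ′ : ColumnList n} → Linked _≤ˡᵉˣ_ Λ → Linked _≤ˡᵉˣ_ Λ′ → Λ ↭ Λ′ → Λ ≡ Λ′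
  sorted-↭⇒≡ Λ↗ Λ′↗ σ = Pointwise.Pointwise-≡⇒≡ (Pointwise.map Pointwise-≡⇒≡
    (↗↭↗⇒≋ totalOrder Λ↗ Λ′↗ (↭⇒↭ₛ′ Eq.isEquivalence σ)))
    where open DecTotalOrder lex

  rowSums-↭ : {Λ Λ′ : ColumnList n} → Λ ↭ Λ′ → rowSums Λ ≡ rowSums Λ′
  rowSums-↭ σ = SetoidPermₚ.foldr-commMonoid (≡.setoid _) +ᵐ-isCommutativeMonoid (↭⇒↭ₛ σ)
    where
    open import Algebra.Structures {A = MultiIndex n} _≡_ using (IsCommutativeMonoid)
    open import Algebra.Structures.Biased {A = MultiIndex n} _≡_ using (isCommutativeMonoidˡ)
    +ᵐ-isCommutativeMonoid : IsCommutativeMonoid _+ᵐ_ 0ᵐ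
    +ᵐ-isCommutativeMonoid = isCommutativeMonoidˡ record
      { isSemigroup = record
        { isMagma = ≡.isMagma _+ᵐ_ ; assoc = Vecₚ.zipWith-assoc ℕₚ.+-assoc }
      ; identityˡ = Vecₚ.zipWith-identityˡ ℕₚ.+-identityˡ
      ; comm = Vecₚ.zipWith-comm ℕₚ.+-comm
      }

  partitionsOfLength : ℕ → MultiIndex n → List (ColumnList n)
  partitionsOfLength k i = filter (λ Λ → k ℕ.≟ length Λ) (partitions i)

  partitionsOfLength-unique : ∀ k i → Unique (partitionsOfLength k i)
  partitionsOfLength-unique k i = Uniqueₚ.filter⁺ (λ Λ → k ℕ.≟ length Λ) (partitions-unique {i = i})

  ∈-partitionsOfLength⁺ : ∀ {k i Λ} → Λ ⊢ i → k ≡ length Λ → Λ ∈ partitionsOfLength k i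
  ∈-partitionsOfLength⁺ {k} Λ⊢i = ∈ₚ.∈-filter⁺ (λ Λ → k ℕ.≟ length Λ) (∈-partitions⁺ Λ⊢i)

  ∈-partitionsOfLength⁻ : ∀ k i {Λ} → Λ ∈ partitionsOfLength k i → Λ ⊢ i × k ≡ length Λ
  ∈-partitionsOfLength⁻ k i Λ∈ =
    let Λ∈i , k≡ = ∈ₚ.∈-filter⁻ (λ Λ → k ℕ.≟ length Λ) {xs = partitions i} Λ∈
    in ∈-partitions⁻ Λ∈i , k≡

  open DecMembership (_≟ᵐ_ {n}) using (_∈?_)

  insertColumn : MultiIndex n → ColumnList n → ColumnList n
  insertColumn = insert

  insertColumn-↭ : ∀ c Λ → insertColumn c Λ ↭ c ∷ Λ
  insertColumn-↭ = insert-↭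

  -- Inserting `c` is undone by deleting one copy of it. Both lists are free of repetitions, so
  -- comparing members suffices. The insertion creates no zero column because `c ≢ 0ᵐ`, and `c ≤ᵐ i`
  -- makes the truncated difference `i ∸ᵐ c` a true one.
  partitionsContaining-↭ : ∀ {c i} k → c ≢ 0ᵐ → c ≤ᵐ i →
    map (insertColumn c) (partitionsOfLength k (i ∸ᵐ c)) ↭ filter (c ∈?_) (partitionsOfLength (suc k) i)
  partitionsContaining-↭ {c} {i} k c≢0 c≤i = unique∧set⇒↭
    (map-unique injective (partitionsOfLength-unique k (i ∸ᵐ c)))
    (Uniqueₚ.filter⁺ (c ∈?_) (partitionsOfLength-unique (suc k) i))
    inserted inserted⁻
    where
    injective : ∀ {Λ Λ′} → Λ ∈ partitionsOfLength k (i ∸ᵐ c) → Λ′ ∈ partitionsOfLength k (i ∸ᵐ c) →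
                insertColumn c Λ ≡ insertColumn c Λ′ → Λ ≡ Λ′
    -- Equal results make `c ∷ Λ` and `c ∷ Λ′` permutations of each other; `c` cancels, and
    -- sortedness turns the remaining permutation into an equality.
    injective {Λ} {Λ′} Λ∈ Λ′∈ eq = sorted-↭⇒≡
      (_⊢_.sorted (proj₁ (∈-partitionsOfLength⁻ k (i ∸ᵐ c) Λ∈)))
      (_⊢_.sorted (proj₁ (∈-partitionsOfLength⁻ k (i ∸ᵐ c) Λ′∈)))
      (Permₚ.drop-∷ (↭-trans (↭-sym (insertColumn-↭ c Λ))
        (≡.subst (_↭ c ∷ Λ′) (≡.sym eq) (insertColumn-↭ c Λ′))))

    inserted : ∀ {Λ} → Λ ∈ map (insertColumn c) (partitionsOfLength k (i ∸ᵐ c)) →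
               Λ ∈ filter (c ∈?_) (partitionsOfLength (suc k) i)
    inserted Λ∈ with Λ′ , Λ′∈ , ≡.refl ← ∈ₚ.∈-map⁻ (insertColumn c) Λ∈
                with partition nz ↗ sums , k≡ ← ∈-partitionsOfLength⁻ k (i ∸ᵐ c) Λ′∈
      = ∈ₚ.∈-filter⁺ (c ∈?_)
          (∈-partitionsOfLength⁺
            (partition (Permₚ.All-resp-↭ (↭-sym σ) (c≢0 ∷ nz)) (insert-↗ c ↗)
              (≡.trans (rowSums-↭ σ) (≡.trans (≡.cong (c +ᵐ_) sums) (j+[i∸j]≡i c≤i))))
            (≡.trans (≡.cong suc k≡) (≡.sym (Permₚ.↭-length σ))))
          (Permₚ.∈-resp-↭ (↭-sym σ) (here ≡.refl))
      where σ = insertColumn-↭ c Λ′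

    inserted⁻ : ∀ {Λ} → Λ ∈ filter (c ∈?_) (partitionsOfLength (suc k) i) →
                Λ ∈ map (insertColumn c) (partitionsOfLength k (i ∸ᵐ c))
    inserted⁻ {Λ} Λ∈ with Λ∈′ , c∈Λ ← ∈ₚ.∈-filter⁻ (c ∈?_) {xs = partitionsOfLength (suc k) i} Λ∈
                     with partition nz ↗ sums , k≡ ← ∈-partitionsOfLength⁻ (suc k) i Λ∈′
                     with ys , zs , ≡.refl ← ∈ₚ.∈-∃++ c∈Λ
      -- Splitting `Λ` around one copy of `c` yields the preimage `sort (ys ++ zs)`. Sorting afresh
      -- avoids a proof that deletion preserves the order.
      = ≡.subst (_∈ map (insertColumn c) (partitionsOfLength k (i ∸ᵐ c)))
          (≡.sym (sorted-↭⇒≡ ↗ (insert-↗ c (sort-↗ rest)) σ))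
          (∈ₚ.∈-map⁺ (insertColumn c) (∈-partitionsOfLength⁺
            (partition (All.tail (Permₚ.All-resp-↭ τ nz)) (sort-↗ rest) rest-sums)
            (ℕₚ.suc-injective (≡.trans k≡ (Permₚ.↭-length τ)))))
      where
      rest = ys ++ zs
      τ : Λ ↭ c ∷ sort rest
      τ = ↭-trans (Permₚ.shift c ys zs) (↭-prep c (↭-sym (sort-↭ rest)))
      σ : Λ ↭ insertColumn c (sort rest)
      σ = ↭-trans τ (↭-sym (insertColumn-↭ c (sort rest)))
      rest-sums : rowSums (sort rest) ≡ i ∸ᵐ c
      rest-sums = ≡.trans (≡.sym (+ᵐ-∸ᵐ-cancel c (rowSums (sort rest))))
        (≡.cong (_∸ᵐ c) (≡.trans (≡.sym (rowSums-↭ τ)) sums))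

  multiplicity-↭ : ∀ c {Λ Λ′ : ColumnList n} → Λ ↭ Λ′ → multiplicity c Λ ≡ multiplicity c Λ′
  multiplicity-↭ c σ = Permₚ.↭-length (Permₚ.filter-↭ (c ≟ᵐ_) σ)

  multiplicity-∉ : ∀ {c} {Λ : ColumnList n} → c ∉ Λ → multiplicity c Λ ≡ 0
  multiplicity-∉ {c} c∉Λ = ≡.cong length
    (Listₚ.filter-none (c ≟ᵐ_) (All.tabulate λ { x∈ ≡.refl → c∉Λ x∈ }))

  multiplicity-here : ∀ c (Λ : ColumnList n) → multiplicity c (c ∷ Λ) ≡ suc (multiplicity c Λ)
  multiplicity-here c Λ = ≡.cong length (Listₚ.filter-accept (c ≟ᵐ_) {xs = Λ} ≡.refl)

  multiplicity-there : ∀ {b c} (Λ : ColumnList n) → b ≢ c → multiplicity b (c ∷ Λ) ≡ multiplicity b Λ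
  multiplicity-there {b} Λ b≢c = ≡.cong length (Listₚ.filter-reject (b ≟ᵐ_) {xs = Λ} b≢c)

  distinctColumns-unique : (Λ : ColumnList n) → Unique (distinctColumns Λ)
  distinctColumns-unique = DecUniqueₚ.deduplicate-! _≟ᵐ_

  ∈-distinctColumns⁺ : {Λ : ColumnList n} → ∀ {c} → c ∈ Λ → c ∈ distinctColumns Λ
  ∈-distinctColumns⁺ = ∈ₚ.∈-deduplicate⁺ _≟ᵐ_

  ∈-distinctColumns⁻ : (Λ : ColumnList n) → ∀ {c} → c ∈ distinctColumns Λ → c ∈ Λ
  ∈-distinctColumns⁻ Λ = ∈ₚ.∈-deduplicate⁻ _≟ᵐ_ Λ

  distinctColumns-↭ : {Λ Λ′ : ColumnList n} → Λ ↭ Λ′ → distinctColumns Λ ↭ distinctColumns Λ′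
  distinctColumns-↭ {Λ} {Λ′} σ = unique∧set⇒↭ (distinctColumns-unique Λ) (distinctColumns-unique Λ′)
    (∈-distinctColumns⁺ ∘ Permₚ.∈-resp-↭ σ ∘ ∈-distinctColumns⁻ Λ)
    (∈-distinctColumns⁺ ∘ Permₚ.∈-resp-↭ (↭-sym σ) ∘ ∈-distinctColumns⁻ Λ′)

-- Natural numbers inside a field of characteristic zero.

module FieldProperties {c ℓ₁ ℓ₂} (K : CharZeroField c ℓ₁ ℓ₂) where

  open CharZeroField K
  open CommutativeRing commutativeRing public
    using (commutativeSemiring; ring; +-commutativeMonoid; *-commutativeMonoid)
  open CommutativeSemigroupₚ (CommutativeRing.*-commutativeSemigroup commutativeRing) public
    using (interchange; x∙yz≈y∙xz; xy∙z≈xz∙y; xy∙z≈y∙xz)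
  open Multₚ semiring using (×1-homo-*)
  open Ringₚ ring using (-0#≈0#)
  open SetoidReasoning setoid

  module ∑ = BigOperator +-commutativeMonoid
  module ∏ = BigOperator *-commutativeMonoid

  ι : ℕ → Carrier
  ι m = m ·ℕ 1#

  x-0≈x : ∀ x → x - 0# ≈ x
  x-0≈x x = trans (+-congˡ -0#≈0#) (+-identityʳ x)

  ÷-*-cancel : ∀ x m .{{_ : NonZero m}} → (x ÷ m) * ι m ≈ x
  ÷-*-cancel x m = begin
    x * m⁻¹ * ι m     ≈⟨ *-assoc x m⁻¹ (ι m) ⟩
    -- Apartness from `0#` makes the difference `ι m - 0#` invertible, so the subtraction has to be
    -- inserted before the inverse law applies.
    x * (m⁻¹ * ι m)   ≈⟨ *-congˡ (trans (*-congˡ (sym (x-0≈x (ι m)))) (proj₁ (proj₂ inverse))) ⟩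
    x * 1#            ≈⟨ *-identityʳ x ⟩
    x                 ∎
    where
    inverse = #⇒invertible (charZero m)
    m⁻¹ = proj₁ inverse

  *-÷-cancel : ∀ x m .{{_ : NonZero m}} → (x * ι m) ÷ m ≈ x
  *-÷-cancel x m = trans (xy∙z≈xz∙y x (ι m) _) (÷-*-cancel x m)

  *-ι-cancelʳ : ∀ {x y} m .{{_ : NonZero m}} → x * ι m ≈ y * ι m → x ≈ y
  *-ι-cancelʳ {x} {y} m eq = begin
    x               ≈⟨ *-÷-cancel x m ⟨
    (x * ι m) ÷ m   ≈⟨ *-congʳ eq ⟩
    (y * ι m) ÷ m   ≈⟨ *-÷-cancel y m ⟩
    y               ∎

  ι-homo-* : ∀ m k → ι (m ℕ.* k) ≈ ι m * ι k
  ι-homo-* = ×1-homo-*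

  ι-homo-^ : ∀ m k → ι (m ℕ.^ k) ≈ ι m ^ k
  ι-homo-^ m zero    = +-identityʳ 1#
  ι-homo-^ m (suc k) = trans (ι-homo-* m (m ℕ.^ k)) (*-congˡ (ι-homo-^ m k))

  ι-homo-product : ∀ (f : X → ℕ) xs → ι (ℕ.product (map f xs)) ≈ ∏ (map (ι ∘ f) xs)
  ι-homo-product f []       = +-identityʳ 1#
  ι-homo-product f (x ∷ xs) = trans (ι-homo-* (f x) _) (*-congˡ (ι-homo-product f xs))

  ι-length : (xs : List X) → ι (length xs) ≈ ∑ (map (λ _ → 1#) xs)
  ι-length []       = refl
  ι-length (x ∷ xs) = +-congˡ (ι-length xs)

  *-distribˡ-∑ : ∀ z (f : X → Carrier) xs → z * ∑ (map f xs) ≈ ∑ (map (λ x → z * f x) xs)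
  *-distribˡ-∑ z f []       = zeroʳ z
  *-distribˡ-∑ z f (x ∷ xs) = trans (distribˡ z _ _) (+-congˡ (*-distribˡ-∑ z f xs))

  *-distribʳ-∑ : ∀ z (f : X → Carrier) xs → ∑ (map f xs) * z ≈ ∑ (map (λ x → f x * z) xs)
  *-distribʳ-∑ z f []       = zeroˡ z
  *-distribʳ-∑ z f (x ∷ xs) = trans (distribʳ z _ _) (+-congˡ (*-distribʳ-∑ z f xs))

-- Weights of partitions and powers of a series.

module PartitionSums {c ℓ₁ ℓ₂} (K : CharZeroField c ℓ₁ ℓ₂) (n : ℕ) where

  open CharZeroField K
  open FieldProperties K
  open PowerSeries K n
  open SetoidReasoning setoid

  dividedPower : Series → MultiIndex n → ℕ → Carrier
  dividedPower s c m = (s c ^ m ÷ m !) {{m ℕₚ.!≢0}}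

  dividedPower-zero : ∀ s c → dividedPower s c 0 ≈ 1#
  dividedPower-zero s c = begin
    1# ÷ 1            ≈⟨ *-identityʳ _ ⟨
    (1# ÷ 1) * 1#     ≈⟨ *-congˡ (+-identityʳ 1#) ⟨
    (1# ÷ 1) * ι 1    ≈⟨ ÷-*-cancel 1# 1 ⟩
    1#                ∎

  -- Multiplied by `ι (m !)`, both sides become `s c ^ suc m`, because `suc m ℕ.* m !` is `suc m !`;
  -- the factor cancels in characteristic zero.
  dividedPower-suc : ∀ s c m → ι (suc m) * dividedPower s c (suc m) ≈ s c * dividedPower s c m
  dividedPower-suc s c m = *-ι-cancelʳ (m !) {{m ℕₚ.!≢0}} (begin
    ι (suc m) * dividedPower s c (suc m) * ι (m !)     ≈⟨ xy∙z≈y∙xz _ _ _ ⟩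
    dividedPower s c (suc m) * (ι (suc m) * ι (m !))   ≈⟨ *-congˡ (ι-homo-* (suc m) (m !)) ⟨
    dividedPower s c (suc m) * ι (suc m !)             ≈⟨ ÷-*-cancel _ (suc m !) {{suc m ℕₚ.!≢0}} ⟩
    s c * s c ^ m                                      ≈⟨ *-congˡ (÷-*-cancel _ (m !) {{m ℕₚ.!≢0}}) ⟨
    s c * (dividedPower s c m * ι (m !))               ≈⟨ *-assoc _ _ _ ⟨
    s c * dividedPower s c m * ι (m !)                 ∎)

  weight : Series → ColumnList n → Carrier
  weight s Λ = ∏ (map (λ c → dividedPower s c (multiplicity c Λ)) (distinctColumns Λ))

  weight-↭ : ∀ s {Λ Λ′} → Λ ↭ Λ′ → weight s Λ ≈ weight s Λ′
  weight-↭ s {Λ} σ = trans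
    (∏.⨁-cong (distinctColumns Λ) (λ {c} _ → reflexive (≡.cong (dividedPower s c) (multiplicity-↭ c σ))))
    (∏.⨁-↭ _ (distinctColumns-↭ σ))

  -- By the definition of `deduplicate`, the distinct columns of `c ∷ Λ` are `c` and those of `Λ`
  -- other than `c`, so only the factor at `c` changes, as in `dividedPower-suc`. If `c` is new, its
  -- factor in `weight s Λ` is a divided power of exponent 0, that is 1.
  weight-∷ : ∀ s c Λ → ι (multiplicity c (c ∷ Λ)) * weight s (c ∷ Λ) ≈ s c * weight s Λ
  weight-∷ s c Λ = begin
    ι (multiplicity c (c ∷ Λ)) *
      (v c (multiplicity c (c ∷ Λ)) * ∏ (map (λ b → v b (multiplicity b (c ∷ Λ))) others))
      ≈⟨ *-congˡ (*-congˡ (∏.⨁-cong others (λ {b} b∈ →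
           reflexive (≡.cong (v b) (multiplicity-there Λ (≢c b∈)))))) ⟩
    ι (multiplicity c (c ∷ Λ)) * (v c (multiplicity c (c ∷ Λ)) * rest)
      ≈⟨ reflexive (≡.cong (λ m → ι m * (v c m * rest)) (multiplicity-here c Λ)) ⟩
    ι (suc (multiplicity c Λ)) * (v c (suc (multiplicity c Λ)) * rest)
      ≈⟨ *-assoc _ _ _ ⟨
    ι (suc (multiplicity c Λ)) * v c (suc (multiplicity c Λ)) * rest
      ≈⟨ *-congʳ (dividedPower-suc s c (multiplicity c Λ)) ⟩
    s c * v c (multiplicity c Λ) * rest
      ≈⟨ *-assoc _ _ _ ⟩
    s c * (v c (multiplicity c Λ) * rest)
      ≈⟨ *-congˡ (∏.⨁-remove _≟ᵐ_ c (distinctColumns-unique Λ) absent) ⟨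
    s c * weight s Λ
      ∎
    where
    v = dividedPower s
    others = filter (¬? ∘ (c ≟ᵐ_)) (distinctColumns Λ)
    rest = ∏ (map (λ b → v b (multiplicity b Λ)) others)
    ≢c : ∀ {b} → b ∈ others → b ≢ c
    ≢c b∈ = proj₂ (∈ₚ.∈-filter⁻ (¬? ∘ (c ≟ᵐ_)) {xs = distinctColumns Λ} b∈) ∘ ≡.sym
    absent : c ∉ distinctColumns Λ → v c (multiplicity c Λ) ≈ 1#
    absent c∉ = trans (reflexive (≡.cong (v c) (multiplicity-∉ (c∉ ∘ ∈-distinctColumns⁺))))
                      (dividedPower-zero s c)

  -- This is the series W_k of the opening comment.
  partitionSum : Series → ℕ → Series
  partitionSum s k i = ∑ (map (weight s) (partitionsOfLength k i))

  -- Every column lies below the row sums, so grouping the columns by value needs only keys from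
  -- `below i`. This index set, unlike the distinct columns, is the same for all partitions of `i`,
  -- which allows the exchange of sums in `partitionSum-suc`.
  length≈∑multiplicity : {i : MultiIndex n} → ∀ {Λ} → Λ ⊢ i →
                         ι (length Λ) ≈ ∑ (map (λ c → ι (multiplicity c Λ)) (below i))
  length≈∑multiplicity {i} {Λ} (partition _ _ ≡.refl) = begin
    ι (length Λ)
      ≈⟨ ι-length Λ ⟩
    ∑ (map (λ _ → 1#) Λ)
      ≈⟨ ∑.⨁-fibres _≟ᵐ_ (λ c → c) Λ (below-unique i)
           (All.lookup (columns-below Λ (VecPointwise.refl ℕₚ.≤-refl))) ⟩
    ∑ (map (λ c → ∑ (map (λ _ → 1#) (filter (c ≟ᵐ_) Λ))) (below i))
      ≈⟨ ∑.⨁-cong (below i) (λ {c} _ → ι-length (filter (c ≟ᵐ_) Λ)) ⟨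
    ∑ (map (λ c → ι (multiplicity c Λ)) (below i))
      ∎

  open DecMembership (_≟ᵐ_ {n}) using (_∈?_)

  multiplicity-∉-* : {c : MultiIndex n} → ∀ {Λ z} → c ∉ Λ → ι (multiplicity c Λ) * z ≈ 0#
  multiplicity-∉-* c∉Λ = trans (*-congʳ (reflexive (≡.cong ι (multiplicity-∉ c∉Λ)))) (zeroˡ _)

  -- Partitions without `c` drop out because their multiplicity is 0. The others arise by inserting
  -- `c` into partitions of `i ∸ᵐ c`, and `weight-∷` compares the weights.
  ∑-multiplicity : ∀ {s} → NoConstantTerm s → ∀ k {i c} → c ≤ᵐ i →
    ∑ (map (λ Λ → ι (multiplicity c Λ) * weight s Λ) (partitionsOfLength (suc k) i))
      ≈ s c * partitionSum s k (i ∸ᵐ c)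
  ∑-multiplicity {s} s₀ k {i} {c} c≤i with c ≟ᵐ 0ᵐ
  -- For the zero column both sides vanish: no partition contains it, and `s` has no constant term.
  ... | yes ≡.refl = begin
    ∑ (map (λ Λ → ι (multiplicity c Λ) * weight s Λ) (partitionsOfLength (suc k) i))
      ≈⟨ ∑-zero _ (partitionsOfLength (suc k) i) (All.tabulate λ Λ∈ →
           multiplicity-∉-* λ c∈ → All.lookup
             (_⊢_.noZeroColumn (proj₁ (∈-partitionsOfLength⁻ (suc k) i Λ∈))) c∈ ≡.refl) ⟩
    0#
      ≈⟨ trans (*-congʳ s₀) (zeroˡ _) ⟨
    s c * partitionSum s k (i ∸ᵐ c)
      ∎
  ... | no c≢0 = begin
    ∑ (map term (partitionsOfLength (suc k) i))
      ≈⟨ ∑.⨁-support (c ∈?_) (partitionsOfLength (suc k) i) (λ _ → multiplicity-∉-*) ⟩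
    ∑ (map term (filter (c ∈?_) (partitionsOfLength (suc k) i)))
      ≈⟨ ∑.⨁-↭ term (partitionsContaining-↭ k c≢0 c≤i) ⟨
    ∑ (map term (map (insertColumn c) (partitionsOfLength k (i ∸ᵐ c))))
      ≈⟨ ∑.⨁-map (insertColumn c) (partitionsOfLength k (i ∸ᵐ c)) ⟩
    ∑ (map (λ Λ → term (insertColumn c Λ)) (partitionsOfLength k (i ∸ᵐ c)))
      ≈⟨ ∑.⨁-cong (partitionsOfLength k (i ∸ᵐ c)) (λ {Λ} _ → term-insert Λ) ⟩
    ∑ (map (λ Λ → s c * weight s Λ) (partitionsOfLength k (i ∸ᵐ c)))
      ≈⟨ *-distribˡ-∑ (s c) (weight s) (partitionsOfLength k (i ∸ᵐ c)) ⟨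
    s c * partitionSum s k (i ∸ᵐ c)
      ∎
    where
    term : ColumnList n → Carrier
    term Λ = ι (multiplicity c Λ) * weight s Λ
    term-insert : ∀ Λ → term (insertColumn c Λ) ≈ s c * weight s Λ
    term-insert Λ = trans
      (*-cong (reflexive (≡.cong ι (multiplicity-↭ c (insertColumn-↭ c Λ)))) (weight-↭ s (insertColumn-↭ c Λ)))
      (weight-∷ s c Λ)

  -- The factor `suc k` is the length of each partition in the sum, hence a sum of multiplicities.
  -- After exchanging the sums, each `c` contributes one term of the convolution that defines `*ₛ`.
  partitionSum-suc : ∀ {s} → NoConstantTerm s → ∀ k i →
                     ι (suc k) * partitionSum s (suc k) i ≈ (s *ₛ partitionSum s k) i
  partitionSum-suc {s} s₀ k i = begin
    ι (suc k) * ∑ (map (weight s) Λs)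
      ≈⟨ *-distribˡ-∑ (ι (suc k)) (weight s) Λs ⟩
    ∑ (map (λ Λ → ι (suc k) * weight s Λ) Λs)
      ≈⟨ ∑.⨁-cong Λs expand ⟩
    ∑ (map (λ Λ → ∑ (map (λ c → ι (multiplicity c Λ) * weight s Λ) (below i))) Λs)
      ≈⟨ ∑.⨁-swap Λs (below i) ⟩
    ∑ (map (λ c → ∑ (map (λ Λ → ι (multiplicity c Λ) * weight s Λ) Λs)) (below i))
      ≈⟨ ∑.⨁-cong (below i) (∑-multiplicity s₀ k {i} ∘ ∈-below⁻) ⟩
    (s *ₛ partitionSum s k) i
      ∎
    where
    Λs = partitionsOfLength (suc k) i
    expand : ∀ {Λ} → Λ ∈ Λs →
             ι (suc k) * weight s Λ ≈ ∑ (map (λ c → ι (multiplicity c Λ) * weight s Λ) (below i))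
    expand {Λ} Λ∈ with Λ⊢i , k≡ ← ∈-partitionsOfLength⁻ (suc k) i Λ∈ = begin
      ι (suc k) * weight s Λ
        ≈⟨ *-congʳ (trans (reflexive (≡.cong ι k≡)) (length≈∑multiplicity Λ⊢i)) ⟩
      ∑ (map (λ c → ι (multiplicity c Λ)) (below i)) * weight s Λ
        ≈⟨ *-distribʳ-∑ (weight s Λ) (λ c → ι (multiplicity c Λ)) (below i) ⟩
      ∑ (map (λ c → ι (multiplicity c Λ) * weight s Λ) (below i))
        ∎

  -- Only the matrix without columns has length 0; its row sums are zero and its weight is an empty
  -- product.
  partitionSum-zero : ∀ s i → partitionSum s 0 i ≈ 1ₛ i
  partitionSum-zero s i with i ≟ᵐ 0ᵐ
  ... | yes ≡.refl = trans (∑.⨁-↭ (weight s) only-[]) (+-identityʳ 1#)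
    where
    only-[] : partitionsOfLength 0 0ᵐ ↭ [] ∷ []
    only-[] = unique∧set⇒↭ (partitionsOfLength-unique 0 0ᵐ) ([] ∷ [])
      (λ {Λ} Λ∈ → empty Λ (proj₂ (∈-partitionsOfLength⁻ 0 0ᵐ Λ∈)))
      (λ { (here ≡.refl) → ∈-partitionsOfLength⁺ (partition [] [] ≡.refl) ≡.refl })
      where
      empty : ∀ Λ → 0 ≡ length Λ → Λ ∈ [] ∷ []
      empty [] _ = here ≡.refl
  ... | no i≢0 = ∑-zero (weight s) (partitionsOfLength 0 i)
    (All.tabulate λ {Λ} Λ∈ → none Λ (∈-partitionsOfLength⁻ 0 i Λ∈))
    where
    none : ∀ Λ → Λ ⊢ i × 0 ≡ length Λ → weight s Λ ≈ 0#
    none [] (partition _ _ 0≡i , _) = ⊥-elim (i≢0 (≡.sym 0≡i))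

  k!*partitionSum≈^ₛ : ∀ {s} → NoConstantTerm s → ∀ k i → ι (k !) * partitionSum s k i ≈ (s ^ₛ k) i
  k!*partitionSum≈^ₛ {s} s₀ zero i =
    trans (*-congʳ (+-identityʳ 1#)) (trans (*-identityˡ _) (partitionSum-zero s i))
  k!*partitionSum≈^ₛ {s} s₀ (suc k) i = begin
    ι (suc k !) * partitionSum s (suc k) i
      ≈⟨ *-congʳ (ι-homo-* (suc k) (k !)) ⟩
    ι (suc k) * ι (k !) * partitionSum s (suc k) i
      ≈⟨ xy∙z≈y∙xz _ _ _ ⟩
    ι (k !) * (ι (suc k) * partitionSum s (suc k) i)
      ≈⟨ *-congˡ (partitionSum-suc s₀ k i) ⟩
    ι (k !) * (s *ₛ partitionSum s k) i
      -- The factorial moves inside the convolution to stand beside `partitionSum s k`, where the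
      -- induction hypothesis applies at every `i ∸ᵐ c`.
      ≈⟨ *-distribˡ-∑ (ι (k !)) _ (below i) ⟩
    ∑ (map (λ c → ι (k !) * (s c * partitionSum s k (i ∸ᵐ c))) (below i))
      ≈⟨ ∑.⨁-cong (below i) (λ {c} _ →
           trans (x∙yz≈y∙xz _ _ _) (*-congˡ (k!*partitionSum≈^ₛ s₀ k (i ∸ᵐ c)))) ⟩
    (s *ₛ s ^ₛ k) i
      ∎

  -- Grouping by length leaves `b l` times W_l for each length `l`, and W_l is the `l`-th power of
  -- `s` divided by `l !`. As `i ≢ 0ᵐ`, the lengths run from 1 to `∣ i ∣`, which matches the shifted
  -- index and the bound used in `compose`.
  ∑-partitions-by-length : ∀ {s} → NoConstantTerm s → (b : ℕ → Carrier) → ∀ {i} → i ≢ 0ᵐ →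
    ∑ (map (λ Λ → b (length Λ) * weight s Λ) (partitions i))
      ≈ ∑ (map (λ k → (b (suc k) ÷ suc k !) {{suc k ℕₚ.!≢0}} * (s ^ₛ suc k) i) (upTo ∣ i ∣))
  ∑-partitions-by-length {s} s₀ b {i} i≢0 = begin
    ∑ (map term (partitions i))
      ≈⟨ ∑.⨁-fibres ℕ._≟_ length (partitions i) lengths! length∈ ⟩
    ∑ (map (λ l → ∑ (map term (partitionsOfLength l i))) (map suc (upTo ∣ i ∣)))
      ≈⟨ ∑.⨁-map suc (upTo ∣ i ∣) ⟩
    ∑ (map (λ k → ∑ (map term (partitionsOfLength (suc k) i))) (upTo ∣ i ∣))
      ≈⟨ ∑.⨁-cong (upTo ∣ i ∣) (λ {k} _ → fibre k) ⟩
    ∑ (map (λ k → (b (suc k) ÷ suc k !) {{suc k ℕₚ.!≢0}} * (s ^ₛ suc k) i) (upTo ∣ i ∣))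
      ∎
    where
    term : ColumnList n → Carrier
    term Λ = b (length Λ) * weight s Λ

    lengths! : Unique (map suc (upTo ∣ i ∣))
    lengths! = Uniqueₚ.map⁺ ℕₚ.suc-injective (Uniqueₚ.upTo⁺ ∣ i ∣)

    length∈ : ∀ {Λ} → Λ ∈ partitions i → length Λ ∈ map suc (upTo ∣ i ∣)
    length∈ {Λ} Λ∈ with ∈-partitions⁻ {i = i} Λ∈
    length∈ {[]}    _ | partition _  _ 0≡i    = ⊥-elim (i≢0 (≡.sym 0≡i))
    -- For a nonempty list, `length≤∣rowSums∣` already reads as the strict bound on the length of
    -- the tail that `upTo` requires.
    length∈ {_ ∷ _} _ | partition nz _ ≡.refl = ∈ₚ.∈-map⁺ suc (∈ₚ.∈-upTo⁺ (length≤∣rowSums∣ nz))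

    fibre : ∀ k → ∑ (map term (partitionsOfLength (suc k) i))
                    ≈ (b (suc k) ÷ suc k !) {{suc k ℕₚ.!≢0}} * (s ^ₛ suc k) i
    fibre k = begin
      ∑ (map term Λs)
        ≈⟨ ∑.⨁-cong Λs (λ {Λ} Λ∈ → *-congʳ (reflexive (≡.cong b
             (≡.sym (proj₂ (∈-partitionsOfLength⁻ (suc k) i Λ∈)))))) ⟩
      ∑ (map (λ Λ → b (suc k) * weight s Λ) Λs)
        ≈⟨ *-distribˡ-∑ (b (suc k)) (weight s) Λs ⟨
      b (suc k) * partitionSum s (suc k) i
        ≈⟨ *-congʳ (÷-*-cancel (b (suc k)) (suc k !) {{suc k ℕₚ.!≢0}}) ⟨
      (b (suc k) ÷ suc k !) {{suc k ℕₚ.!≢0}} * ι (suc k !) * partitionSum s (suc k) i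
        ≈⟨ *-assoc _ _ _ ⟩
      (b (suc k) ÷ suc k !) {{suc k ℕₚ.!≢0}} * (ι (suc k !) * partitionSum s (suc k) i)
        ≈⟨ *-congˡ (k!*partitionSum≈^ₛ s₀ (suc k) i) ⟩
      (b (suc k) ÷ suc k !) {{suc k ℕₚ.!≢0}} * (s ^ₛ suc k) i
        ∎
      where
      Λs = partitionsOfLength (suc k) i

  -- Coefficients of the series 1 and of generating functions.

  1ₛ-0 : 1ₛ 0ᵐ ≈ 1#
  1ₛ-0 with 0ᵐ {n} ≟ᵐ 0ᵐ
  ... | yes _  = refl
  ... | no 0≢0 = ⊥-elim (0≢0 ≡.refl)

  1ₛ-≢0 : ∀ {i} → i ≢ 0ᵐ → 1ₛ i ≈ 0#
  1ₛ-≢0 {i} i≢0 with i ≟ᵐ 0ᵐ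
  ... | yes i≡0 = ⊥-elim (i≢0 i≡0)
  ... | no _    = refl

  generatingFunction-0 : ∀ m → generatingFunction m 0ᵐ ≈ 1#
  generatingFunction-0 m with 0ᵐ {n} ≟ᵐ 0ᵐ
  ... | yes _  = refl
  ... | no 0≢0 = ⊥-elim (0≢0 ≡.refl)

  generatingFunction-≢0 : ∀ m {i} → i ≢ 0ᵐ →
                          generatingFunction m i ≈ (m i ÷ i !ᵐ) {{factorialᵐ-nonZero i}}
  generatingFunction-≢0 m {i} i≢0 with i ≟ᵐ 0ᵐ
  ... | yes i≡0 = ⊥-elim (i≢0 i≡0)
  ... | no _    = refl

  -- Moments of the auxiliary umbra as weighted sums over partitions.

  module _ {a} {A : Set a} (𝔼 : Evaluation K A) where

    open Umbrae 𝔼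
    open Expₚ commutativeSemiring using (^-distrib-*)
    open SemiringExpₚ semiring using (^-congˡ)

    -- With g_c = s_c c!, the power g_c^r is (s_c^r / r!) r! (c!)^r; the three factors multiply up
    -- to the weight, `𝔪[ Λ ]!` and `Λ !ᵖ`. The relation is assumed only on columns of `Λ`, since
    -- for s = f(μ,t) - 1 it fails at `0ᵐ`.
    columnProduct≈weight : ∀ (g : MultiIndex n → Carrier) (s : Series) Λ →
      (∀ {c} → c ∈ Λ → s c * ι (c !ᵐ) ≈ g c) →
      columnProduct g Λ ≈ weight s Λ * ι (𝔪[ Λ ]! ℕ.* Λ !ᵖ)
    columnProduct≈weight g s Λ s≈g = begin
      columnProduct g Λ
        ≈⟨ ∏.⨁-cong cs (λ {c} c∈ → factor c (s≈g (∈-distinctColumns⁻ Λ c∈))) ⟩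
      ∏ (map (λ c → dividedPower s c (m c) * (ι (m c !) * ι (c !ᵐ ℕ.^ m c))) cs)
        ≈⟨ ∏.⨁-∙ cs ⟩
      weight s Λ * ∏ (map (λ c → ι (m c !) * ι (c !ᵐ ℕ.^ m c)) cs)
        ≈⟨ *-congˡ (∏.⨁-∙ cs) ⟩
      weight s Λ * (∏ (map (λ c → ι (m c !)) cs) * ∏ (map (λ c → ι (c !ᵐ ℕ.^ m c)) cs))
        ≈⟨ *-congˡ (*-cong (ι-homo-product _ cs) (ι-homo-product _ cs)) ⟨
      weight s Λ * (ι 𝔪[ Λ ]! * ι (Λ !ᵖ))
        ≈⟨ *-congˡ (ι-homo-* 𝔪[ Λ ]! (Λ !ᵖ)) ⟨
      weight s Λ * ι (𝔪[ Λ ]! ℕ.* Λ !ᵖ)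
        ∎
      where
      cs = distinctColumns Λ
      m : MultiIndex n → ℕ
      m c = multiplicity c Λ
      factor : ∀ c → s c * ι (c !ᵐ) ≈ g c →
               g c ^ m c ≈ dividedPower s c (m c) * (ι (m c !) * ι (c !ᵐ ℕ.^ m c))
      factor c s*c!≈g = begin
        g c ^ m c
          ≈⟨ ^-congˡ (m c) s*c!≈g ⟨
        (s c * ι (c !ᵐ)) ^ m c
          ≈⟨ ^-distrib-* (s c) (ι (c !ᵐ)) (m c) ⟩
        s c ^ m c * ι (c !ᵐ) ^ m c
          ≈⟨ *-cong (÷-*-cancel _ (m c !) {{m c ℕₚ.!≢0}}) (ι-homo-^ (c !ᵐ) (m c)) ⟨
        dividedPower s c (m c) * ι (m c !) * ι (c !ᵐ ℕ.^ m c)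
          ≈⟨ *-assoc _ _ _ ⟩
        dividedPower s c (m c) * (ι (m c !) * ι (c !ᵐ ℕ.^ m c))
          ∎

    -- The factorials produced by `columnProduct≈weight` cancel the denominator of each term and
    -- leave `i !ᵐ`. Columns of a partition are nonzero, so the relation between `s` and the moments
    -- applies to them.
    auxiliaryMoments-weights : ∀ (α : A) (μ : Vec (Monomial A) n) (s : Series) →
      (∀ {c} → c ≢ 0ᵐ → s c * ι (c !ᵐ) ≈ moments μ c) → ∀ i →
      auxiliaryMoments α μ i
        ≈ ∑ (map (λ Λ → moment α (length Λ) * weight s Λ) (partitions i)) * ι (i !ᵐ)
    auxiliaryMoments-weights α μ s s≈g i = trans
      (∑.⨁-cong (partitions i) (λ {Λ} Λ∈ → term Λ (∈-partitions⁻ {i = i} Λ∈)))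
      (sym (*-distribʳ-∑ (ι (i !ᵐ)) _ (partitions i)))
      where
      term : ∀ Λ → Λ ⊢ i →
        (ι (i !ᵐ) ÷ (𝔪[ Λ ]! ℕ.* Λ !ᵖ)) {{𝔪!*!ᵖ-nonZero Λ}}
            * moment α (length Λ) * columnProduct (moments μ) Λ
          ≈ moment α (length Λ) * weight s Λ * ι (i !ᵐ)
      term Λ (partition nz _ _) = begin
        q * x * columnProduct (moments μ) Λ
          ≈⟨ *-congˡ (columnProduct≈weight (moments μ) s Λ (λ c∈ → s≈g (All.lookup nz c∈))) ⟩
        q * x * (weight s Λ * ι M)
          ≈⟨ *-congʳ (*-comm q x) ⟩
        x * q * (weight s Λ * ι M)
          ≈⟨ interchange x q (weight s Λ) (ι M) ⟩
        x * weight s Λ * (q * ι M)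
          ≈⟨ *-congˡ (÷-*-cancel (ι (i !ᵐ)) M {{𝔪!*!ᵖ-nonZero Λ}}) ⟩
        x * weight s Λ * ι (i !ᵐ)
          ∎
        where
        M = 𝔪[ Λ ]! ℕ.* Λ !ᵖ
        q = (ι (i !ᵐ) ÷ M) {{𝔪!*!ᵖ-nonZero Λ}}
        x = moment α (length Λ)

theorem3p1 : ∀ {c ℓ₁ ℓ₂ a} (K : CharZeroField c ℓ₁ ℓ₂) {A : Set a} (𝔼 : Evaluation K A)
               (n : ℕ) (α : A) (μ : Vec (Monomial A) n) →
               let open PowerSeries K n
                   open Umbrae 𝔼
               in f⟨ α ∙β∙ μ ⟩ ≈ₛ f[ α , f⟨ μ ⟩ -ₛ 1ₛ ] (generatingFunction-1-noConstantTerm (moments μ))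
theorem3p1 K 𝔼 n α μ i = coefficient i (i ≟ᵐ 0ᵐ)
  where
  open CharZeroField K
  open FieldProperties K
  open PowerSeries K n
  open PartitionSums K n
  open Umbrae 𝔼
  open SetoidReasoning setoid

  s : Series
  s = f⟨ μ ⟩ -ₛ 1ₛ

  s₀ : NoConstantTerm s
  s₀ = generatingFunction-1-noConstantTerm (moments μ)

  s-≢0 : ∀ {c} → c ≢ 0ᵐ → s c * ι (c !ᵐ) ≈ moments μ c
  s-≢0 {c} c≢0 = begin
    (f⟨ μ ⟩ c - 1ₛ c) * ι (c !ᵐ)
      ≈⟨ *-congʳ (+-cong (generatingFunction-≢0 (moments μ) c≢0) (-‿cong (1ₛ-≢0 c≢0))) ⟩
    ((moments μ c ÷ c !ᵐ) {{factorialᵐ-nonZero c}} - 0#) * ι (c !ᵐ)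
      ≈⟨ *-congʳ (x-0≈x _) ⟩
    (moments μ c ÷ c !ᵐ) {{factorialᵐ-nonZero c}} * ι (c !ᵐ)
      ≈⟨ ÷-*-cancel (moments μ c) (c !ᵐ) {{factorialᵐ-nonZero c}} ⟩
    moments μ c
      ∎

  -- The truncation `d` is kept apart from the index because `∣ 0ᵐ ∣` does not compute to 0 for a
  -- variable `n`; at `0ᵐ` it is replaced by 0 along `∣0ᵐ∣≡0`, which empties the sum.
  powers : ℕ → Series
  powers d i = ∑ (map (λ k → (moment α (suc k) ÷ suc k !) {{suc k ℕₚ.!≢0}} * (s ^ₛ suc k) i) (upTo d))

  -- The right side is what the coefficient of `f[ α , s ] s₀` unfolds to, `∣ i ∣` being the bound
  -- in `powers-locallyFinite`. The index `0ᵐ` is separate because a generating function has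
  -- constant term 1 by definition, not through a moment.
  coefficient : ∀ i → Dec (i ≡ 0ᵐ) → f⟨ α ∙β∙ μ ⟩ i ≈ 1ₛ i + (powers ∣ i ∣ i)
  coefficient i (yes ≡.refl) = begin
    f⟨ α ∙β∙ μ ⟩ 0ᵐ                  ≈⟨ generatingFunction-0 (auxiliaryMoments α μ) ⟩
    1#                               ≈⟨ 1ₛ-0 ⟨
    1ₛ 0ᵐ                            ≈⟨ +-identityʳ _ ⟨
    1ₛ 0ᵐ + 0#                       ≈⟨ +-congˡ (reflexive (≡.cong (λ d → powers d 0ᵐ) (∣0ᵐ∣≡0 n))) ⟨
    1ₛ 0ᵐ + (powers ∣ 0ᵐ {n} ∣ 0ᵐ)   ∎
  coefficient i (no i≢0) = begin
    f⟨ α ∙β∙ μ ⟩ i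
      ≈⟨ generatingFunction-≢0 (auxiliaryMoments α μ) i≢0 ⟩
    (auxiliaryMoments α μ i ÷ i !ᵐ) {{factorialᵐ-nonZero i}}
      ≈⟨ *-congʳ (auxiliaryMoments-weights 𝔼 α μ s s-≢0 i) ⟩
    ((∑ (map (λ Λ → moment α (length Λ) * weight s Λ) (partitions i)) * ι (i !ᵐ)) ÷ i !ᵐ)
      {{factorialᵐ-nonZero i}}
      ≈⟨ *-÷-cancel _ (i !ᵐ) {{factorialᵐ-nonZero i}} ⟩
    ∑ (map (λ Λ → moment α (length Λ) * weight s Λ) (partitions i))
      ≈⟨ ∑-partitions-by-length s₀ (moment α) i≢0 ⟩
    (powers ∣ i ∣ i)
      ≈⟨ +-identityˡ _ ⟨
    0# + (powers ∣ i ∣ i)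
      ≈⟨ +-congʳ (1ₛ-≢0 i≢0) ⟨
    1ₛ i + (powers ∣ i ∣ i)
      ∎
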